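{- Let $G=(V,E)$ be an intersecting hypergraph and $c\colon V\to\{0,1\}$ a colouring such that every $c$-monochromatic hitting set for $G$ has size at least $h$, where $h>r(G)$. Then there exist a partial function $f\colon\{0,1\}^V\to\{0,1,*\}$ and an input $x\in f^{ -1}(*)$ such that $\mathrm{C}(f)\le r(G)$ and $\min\{\mathrm{C}_{\bar 0}(f,x),\mathrm{C}_{\bar 1}(f,x)\}\ge h$. Moreover $f$ can be taken monotone, in the sense that flipping any input bit from $0$ to $1$ never changes the value from $1$ to $0$ or $*$, nor from $*$ to $0$.
   Context: A hypergraph $G=(V,E)$ is intersecting if $e\cap e'\neq\emptyset$ for all $e,e'\in E$. A set $U\subseteq V$ is a hitting set if it intersects every edge; it is $c$-monochromatic if $c$ is constant on $U$. The rank $r(G)$ is the maximum edge size. For a partial function $f\colon\{0,1\}^V\to\{0,1,*\}$: a partial input $\rho\in\{0,1,*\}^V$ is consistent with $x$ if $\rho_v=x_v$ whenever $\rho_v\neq*$; $|\rho|$ is the number of non-$*$ entries; for $\Sigma\subseteq\{0,1,*\}$, $\rho$ is a $\Sigma$-certificate for $x$ if it is consistent with $x$ and $f(x')\in\Sigma$ for all $x'$ consistent with $\rho$; $\mathrm{C}_\Sigma(f,x)$ is the least size of such a certificate, $\mathrm{C}_\Sigma(f)=\max_{x\in f^{ -1}(\Sigma)}\mathrm{C}_\Sigma(f,x)$; $0,1,\bar0,\bar1$ denote $\Sigma=\{0\},\{1\},\{1,*\},\{0,*\}$; $\mathrm{C}(f)=\max\{\mathrm{C}_0(f),\mathrm{C}_1(f)\}$.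 -}

module Defs where

open import Data.Bool using (Bool; true; false)
import Data.Bool.Properties as Bool
open import Data.Fin using (Fin)
open import Data.Fin.Properties using (all?)
open import Data.Fin.Subset using (Subset; Nonempty; _∩_; ∣_∣)
  renaming (_∈_ to _∈ˢ_)
open import Data.Fin.Subset.Properties using (anySubset?)
open import Data.List using (List; []; _∷_; map; filter; cartesianProductWith)
open import Data.List.Extrema.Nat using (min; max)
open import Data.List.Membership.Propositional using (_∈_)
open import Data.List.Membership.Propositional.Properties
  using (∈-cartesianProductWith⁺)
import Data.List.Membership.DecPropositional as DecMembership
open import Data.List.Relation.Unary.Any using (here; there)
open import Data.Maybe using (Maybe; just; nothing; is-just)
open import Data.Maybe.Properties using (≡-dec)
open import Data.Nat using (ℕ; zero; suc; _⊔_)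
open import Data.Product using (_×_; _,_)
open import Data.Vec as Vec using (Vec; lookup; _[_]≔_)
open import Relation.Binary.Definitions using (DecidableEquality)
open import Relation.Binary.PropositionalEquality using (_≡_; _≢_; refl)
open import Relation.Nullary using (Dec)
open import Relation.Nullary.Decidable
  using (map′; ¬?; _×-dec_; _→-dec_; decidable-stable)

private
  variable
    n : ℕ

-- Hypergraphs on the vertex set V = Fin n, given by listing the edges.
-- Nothing below depends on the order or the multiplicity of the edges.

Hypergraph : ℕ → Set
Hypergraph n = List (Subset n)

Intersecting : Hypergraph n → Set
Intersecting G = ∀ {e e′} → e ∈ G → e′ ∈ G → Nonempty (e ∩ e′)

HittingSet : Hypergraph n → Subset n → Set
HittingSet G U = ∀ {e} → e ∈ G → Nonempty (U ∩ e)

rank : Hypergraph n → ℕ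
rank G = max 0 (map ∣_∣ G)

Colouring : ℕ → Set
Colouring n = Fin n → Bool

Monochromatic : Colouring n → Subset n → Set
Monochromatic c U = ∀ {u v} → u ∈ˢ U → v ∈ˢ U → c u ≡ c v

-- {0,1} is Bool and {0,1,*} is Maybe Bool.

Value : Set
Value = Maybe Bool

pattern 𝟎 = just false
pattern 𝟏 = just true
pattern ⋆ = nothing

values : List Value
values = 𝟎 ∷ 𝟏 ∷ ⋆ ∷ []

_≟ⱽ_ : DecidableEquality Value
_≟ⱽ_ = ≡-dec Bool._≟_

open DecMembership _≟ⱽ_ using (_∈?_)

Input : ℕ → Set
Input n = Vec Bool n

PartialInput : ℕ → Set
PartialInput n = Vec Value n

PartialFunction : ℕ → Set
PartialFunction n = Input n → Value

size : PartialInput n → ℕ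
size ρ = ∣ Vec.map is-just ρ ∣

Consistent : PartialInput n → Input n → Set
Consistent ρ x = ∀ v → lookup ρ v ≢ ⋆ → lookup ρ v ≡ just (lookup x v)

consistent? : (ρ : PartialInput n) (x : Input n) → Dec (Consistent ρ x)
consistent? ρ x =
  all? λ v → ¬? (lookup ρ v ≟ⱽ ⋆) →-dec (lookup ρ v ≟ⱽ just (lookup x v))

-- The sets Σ ⊆ {0,1,*}, written S because Σ is taken, are lists of values.

Certificate : List Value → PartialFunction n → Input n → PartialInput n → Set
Certificate S f x ρ = Consistent ρ x × (∀ x′ → Consistent ρ x′ → f x′ ∈ S)

certificate? : ∀ S (f : PartialFunction n) x ρ → Dec (Certificate S f x ρ)
certificate? S f x ρ = consistent? ρ x ×-dec
  map′ (λ none x′ → decidable-stable (good? x′) λ bad → none (x′ , bad))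
       (λ good (x′ , bad) → bad (good x′))
       (¬? (anySubset? λ x′ → ¬? (good? x′)))
  where
  good? : ∀ x′ → Dec (Consistent ρ x′ → f x′ ∈ S)
  good? x′ = consistent? ρ x′ →-dec (f x′ ∈? S)

allVecs : {A : Set} → List A → ∀ n → List (Vec A n)
allVecs xs zero    = Vec.[] ∷ []
allVecs xs (suc n) = cartesianProductWith Vec._∷_ xs (allVecs xs n)

inputs : ∀ n → List (Input n)
inputs = allVecs (false ∷ true ∷ [])

partialInputs : ∀ n → List (PartialInput n)
partialInputs = allVecs values

∈-allVecs : {A : Set} {xs : List A} → (∀ a → a ∈ xs) →
            (v : Vec A n) → v ∈ allVecs xs n
∈-allVecs all Vec.[]      = here refl
∈-allVecs all (a Vec.∷ v) =
  ∈-cartesianProductWith⁺ Vec._∷_ (all a) (∈-allVecs all v)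

∈-inputs : (x : Input n) → x ∈ inputs n
∈-inputs = ∈-allVecs λ { false → here refl ; true → there (here refl) }

∈-partialInputs : (ρ : PartialInput n) → ρ ∈ partialInputs n
∈-partialInputs = ∈-allVecs λ
  { 𝟎 → here refl ; 𝟏 → there (here refl) ; ⋆ → there (there (here refl)) }

-- C_Σ(f,x), meant for f x ∈ Σ. There x itself is a certificate of size n, so
-- the initial value n of the minimum has no effect.

C-at : List Value → PartialFunction n → Input n → ℕ
C-at {n} S f x = min n (map size (filter (certificate? S f x) (partialInputs n)))

-- C_Σ(f), which is 0 when f⁻¹(Σ) is empty.

C-of : List Value → PartialFunction n → ℕ
C-of {n} S f = max 0 (map (C-at S f) (filter (λ x → f x ∈? S) (inputs n)))

only-0 only-1 not-0 not-1 : List Value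
only-0 = 𝟎 ∷ []
only-1 = 𝟏 ∷ []
not-0  = 𝟏 ∷ ⋆ ∷ []
not-1  = 𝟎 ∷ ⋆ ∷ []

C : PartialFunction n → ℕ
C f = C-of only-0 f ⊔ C-of only-1 f

Monotone : PartialFunction n → Set
Monotone f = ∀ x v → lookup x v ≡ false →
  let x⁺ = x [ v ]≔ true in
  (f x ≡ 𝟏 → f x⁺ ≢ 𝟎 × f x⁺ ≢ ⋆) × (f x ≡ ⋆ → f x⁺ ≢ 𝟎)

{-# OPTIONS --safe #-}

-- Let f x be b when some edge is constantly b in x, and ∗ when no edge is
-- monochromatic; f is well defined because edges intersect pairwise. An edge
-- witnessing f x = b is itself a certificate, so C f ≤ rank G. Take the
-- colouring c as the hard input. A c-monochromatic edge would be a hitting set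
-- of size < h, so f c = ∗. If ρ is consistent with c and rules out the value b,
-- then the positions where ρ is the opposite value hit every edge: an edge they
-- miss could be completed to b. They are c-monochromatic, hence at least h many.
module Submission where

open import Defs
open import Data.Bool using (Bool; true; false; not; if_then_else_)
import Data.Bool.Properties as Bool
open import Data.Fin using (Fin)
import Data.Fin.Properties as Fin
open import Data.Fin.Subset using (Subset; Nonempty; _∩_; ∣_∣)
  renaming (_∈_ to _∈ˢ_)
open import Data.Fin.Subset.Properties
  using (nonempty?; x∈p∩q⁺; x∈p∩q⁻; p⊆q⇒∣p∣≤∣q∣; ∣p∣≤n)
  renaming (_∈?_ to _∈ˢ?_)
open import Data.List using (List; []; _∷_)
open import Data.List.Extrema.Nat using (min≤v⁺; v≤min⁺; max≤v⁺; v≤max⁺)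
open import Data.List.Membership.Propositional using (_∈_; find; lose)
open import Data.List.Membership.Propositional.Properties using (∈-filter⁺)
import Data.List.Relation.Unary.All as All
open import Data.List.Relation.Unary.All.Properties as All using (all-filter)
open import Data.List.Relation.Unary.Any using (Any; any?; here; there)
import Data.List.Relation.Unary.Any as Any
import Data.List.Relation.Unary.Any.Properties as Any
open import Data.Maybe using (just; nothing; is-just; fromMaybe)
open import Data.Maybe.Properties using (just-injective)
open import Data.Nat using (ℕ; _≤_; _<_; _⊓_; z≤n)
open import Data.Nat.Properties
  using (≤-refl; ≤-reflexive; ≤-trans; <⇒≱; ⊔-lub; ⊓-glb)
open import Data.Product using (Σ-syntax; _×_; _,_)
open import Data.Sum using (inj₂)
open import Data.Vec as Vec using (lookup; tabulate; _[_]≔_)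
open import Data.Vec.Properties
  using ( []=⇒lookup; lookup⇒[]=; lookup-map; lookup∘tabulate; map-∘; map-id
        ; map-cong; lookup∘update; lookup∘update′ )
open import Data.Vec.Relation.Binary.Pointwise.Extensional
  using (ext; Pointwise-≡⇒≡)
open import Function using (_∘_)
open import Relation.Binary.PropositionalEquality
  using (_≡_; _≢_; refl; sym; trans; cong; subst)
open import Relation.Nullary using (Dec; yes; no; does; ¬_; contradiction)
open import Relation.Nullary.Decidable using (_→-dec_; dec-true; decidable-stable)

private
  variable
    n h k : ℕ
    b : Bool
    S : List Value

just⇒≢⋆ : ∀ {a : Value} → a ≡ just b → a ≢ ⋆
just⇒≢⋆ refl ()

-- Monochromatic edges and the function they define.

Constant : Bool → Input n → Subset n → Set
Constant b x e = ∀ v → v ∈ˢ e → lookup x v ≡ b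

ConstantEdge : Hypergraph n → Bool → Input n → Set
ConstantEdge G b x = Any (Constant b x) G

constantEdge? : ∀ (G : Hypergraph n) b x → Dec (ConstantEdge G b x)
constantEdge? G b x =
  any? (λ e → Fin.all? λ v → (v ∈ˢ? e) →-dec (lookup x v Bool.≟ b)) G

-- The value 1 takes precedence if constant edges of both kinds exist, a case that
-- `constantEdges-agree` rules out for intersecting `G`.
edgeValue : Hypergraph n → PartialFunction n
edgeValue G x with constantEdge? G true x | constantEdge? G false x
... | yes _ | _     = 𝟏
... | no  _ | yes _ = 𝟎
... | no  _ | no  _ = ⋆

edgeValue⁻ : ∀ (G : Hypergraph n) x → edgeValue G x ≡ just b → ConstantEdge G b x
edgeValue⁻ G x eq with constantEdge? G true x | constantEdge? G false x
edgeValue⁻ G x refl | yes t | _     = t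
edgeValue⁻ G x refl | no  _ | yes f = f

-- The two edges share a vertex, and the bit of `x` there is both `a` and `b`.
constantEdges-agree : ∀ {G : Hypergraph n} x {a} → Intersecting G →
  ConstantEdge G a x → ConstantEdge G b x → a ≡ b
constantEdges-agree x int p q with find p | find q
... | e , e∈G , ce | e′ , e′∈G , ce′ with int e∈G e′∈G
...   | v , v∈e∩e′ with x∈p∩q⁻ e e′ v∈e∩e′
...     | v∈e , v∈e′ = trans (sym (ce v v∈e)) (ce′ v v∈e′)

edgeValue⁺ : ∀ {G : Hypergraph n} x → Intersecting G →
  ConstantEdge G b x → edgeValue G x ≡ just b
edgeValue⁺ {b = b} {G = G} x int p
  with constantEdge? G true x | constantEdge? G false x
... | yes t | _     = cong just (constantEdges-agree x int t p)
... | no  _ | yes f = cong just (constantEdges-agree x int f p)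
edgeValue⁺ {b = true}  x int p | no ¬t | no _  = contradiction p ¬t
edgeValue⁺ {b = false} x int p | no _  | no ¬f = contradiction p ¬f

edgeValue-⋆ : ∀ {G : Hypergraph n} {x} →
  (∀ b → ¬ ConstantEdge G b x) → edgeValue G x ≡ ⋆
edgeValue-⋆ {G = G} {x = x} none with edgeValue G x in eq
... | just b  = contradiction (edgeValue⁻ G x eq) (none b)
... | nothing = refl

-- Monotonicity.

module _ (x : Input n) (v : Fin n) where

  private
    x⁺ = x [ v ]≔ true

  raise-true : ∀ w → lookup x w ≡ true → lookup x⁺ w ≡ true
  raise-true w xw with w Fin.≟ v
  ... | yes refl = lookup∘update v x true
  ... | no  w≢v  = trans (lookup∘update′ w≢v x true) xw

  raise-false : ∀ w → lookup x⁺ w ≡ false → lookup x w ≡ false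
  raise-false w x⁺w with w Fin.≟ v
  ... | yes refl = contradiction (trans (sym (lookup∘update v x true)) x⁺w) λ ()
  ... | no  w≢v  = trans (sym (lookup∘update′ w≢v x true)) x⁺w

-- Raising a bit keeps an edge of ones constant, and undoing this keeps an edge of zeros constant.
-- So the value 1 persists upwards and the value 0 persists downwards.
edgeValue-monotone : ∀ {G : Hypergraph n} → Intersecting G → Monotone (edgeValue G)
edgeValue-monotone {G = G} int x v _ =
  (λ fx≡𝟏 → (λ fx⁺≡𝟎 → contradiction (trans (sym (preserved fx≡𝟏)) fx⁺≡𝟎) λ ())
          , just⇒≢⋆ (preserved fx≡𝟏)) ,
  (λ fx≡⋆ fx⁺≡𝟎 → just⇒≢⋆ (reflected fx⁺≡𝟎) fx≡⋆)
  where
  x⁺ = x [ v ]≔ true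

  preserved : edgeValue G x ≡ 𝟏 → edgeValue G x⁺ ≡ 𝟏
  preserved eq = edgeValue⁺ x⁺ int
    (Any.map (λ const w → raise-true x v w ∘ const w) (edgeValue⁻ G x eq))

  reflected : edgeValue G x⁺ ≡ 𝟎 → edgeValue G x ≡ 𝟎
  reflected eq = edgeValue⁺ x int
    (Any.map (λ const w → raise-false x v w ∘ const w) (edgeValue⁻ G x⁺ eq))

-- Bounding certificate complexity from above and below.

C-at-≤ : ∀ (f : PartialFunction n) x ρ →
  Certificate S f x ρ → C-at S f x ≤ size ρ
C-at-≤ {n} {S = S} f x ρ cert =
  min≤v⁺ n _ (inj₂ (Any.map⁺ (lose
    (∈-filter⁺ (certificate? S f x) (∈-partialInputs ρ) cert) ≤-refl)))

C-of-≤ : ∀ (f : PartialFunction n) →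
  (∀ x → f x ∈ S → C-at S f x ≤ k) → C-of S f ≤ k
C-of-≤ f bound = max≤v⁺ z≤n (All.map⁺ (All.map (λ {x} → bound x) (all-filter _ (inputs _))))

≤-C-at : ∀ (f : PartialFunction n) {x} → f x ∈ S →
  (∀ ρ → Certificate S f x ρ → h ≤ size ρ) → h ≤ C-at S f x
≤-C-at {n} {S = S} f {x} fx∈S bound =
  -- The minimum in `C-at` starts from `n`, so `h ≤ n` must hold too. It does because `x` itself,
  -- with every position fixed, is a certificate.
  v≤min⁺ (≤-trans (bound full full-certifies) (∣p∣≤n (Vec.map is-just full)))
         (All.map⁺ (All.map (λ {ρ} → bound ρ) (all-filter _ (partialInputs n))))
  where
  full : PartialInput n
  full = Vec.map just x

  lookup-full : ∀ v → lookup full v ≡ just (lookup x v)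
  lookup-full v = lookup-map v just x

  determines : ∀ x′ → Consistent full x′ → x ≡ x′
  determines x′ con = Pointwise-≡⇒≡ (ext λ v → just-injective
    (trans (sym (lookup-full v)) (con v (just⇒≢⋆ (lookup-full v)))))

  full-certifies : Certificate S f x full
  full-certifies = (λ v _ → lookup-full v)
                 , (λ x′ con → subst (λ y → f y ∈ S) (determines x′ con) fx∈S)

-- Edges as certificates.

paint : Bool → Subset n → PartialInput n
paint b = Vec.map λ i → if i then just b else ⋆

size-paint : ∀ b (e : Subset n) → size (paint b e) ≡ ∣ e ∣
size-paint b e = cong ∣_∣ (trans (sym (map-∘ is-just _ e))
  (trans (map-cong (λ { true → refl ; false → refl }) e) (map-id e)))

-- Together with `paint-constant`, this makes a painted edge of an intersecting hypergraph a
-- certificate for `b`: consistency with it amounts to the edge being constantly `b`.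
paint-consistent : ∀ (x : Input n) {e} → Constant b x e → Consistent (paint b e) x
paint-consistent {b = b} x {e} ce v ≢⋆
  rewrite lookup-map v (λ i → if i then just b else ⋆) e with lookup e v in eq
... | true  = cong just (sym (ce v (lookup⇒[]= v e eq)))
... | false = contradiction refl ≢⋆

paint-constant : ∀ (x : Input n) {e} → Consistent (paint b e) x → Constant b x e
paint-constant {b = b} x {e} con v v∈e =
  just-injective (trans (sym (con v (just⇒≢⋆ painted))) painted)
  where
  painted : lookup (paint b e) v ≡ just b
  painted = trans (lookup-map v _ e) (cong (λ i → if i then just b else ⋆) ([]=⇒lookup v∈e))

∣edge∣≤rank : ∀ {G : Hypergraph n} {e} → e ∈ G → ∣ e ∣ ≤ rank G
∣edge∣≤rank {G = G} e∈G =
  v≤max⁺ 0 _ (inj₂ (Any.map⁺ (Any.map (λ { refl → ≤-refl }) e∈G)))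

C-edgeValue≤rank : ∀ {G : Hypergraph n} → Intersecting G → C (edgeValue G) ≤ rank G
C-edgeValue≤rank {n} {G} int = ⊔-lub (C-of-≤ f (bound false)) (C-of-≤ f (bound true))
  where
  f = edgeValue G

  bound : ∀ b x → f x ∈ (just b ∷ []) → C-at (just b ∷ []) f x ≤ rank G
  bound b x (here fx) with find (edgeValue⁻ G x fx)
  ... | e , e∈G , ce = ≤-trans
    (C-at-≤ f x (paint b e) (paint-consistent x ce ,
      λ x′ con → here (edgeValue⁺ x′ int (lose e∈G (paint-constant x′ con)))))
    (≤-trans (≤-reflexive (size-paint b e)) (∣edge∣≤rank e∈G))

-- Hitting sets from certificates.

level : Value → PartialInput n → Subset n
level a = Vec.map λ a′ → does (a′ ≟ⱽ a)

∈-level⁺ : ∀ {a} (ρ : PartialInput n) {v} → lookup ρ v ≡ a → v ∈ˢ level a ρ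
∈-level⁺ {a = a} ρ {v} eq =
  lookup⇒[]= v _ (trans (lookup-map v _ ρ) (dec-true (lookup ρ v ≟ⱽ a) eq))

∈-level⁻ : ∀ {a} (ρ : PartialInput n) {v} → v ∈ˢ level a ρ → lookup ρ v ≡ a
∈-level⁻ {a = a} ρ {v} v∈ 
  with lookup ρ v ≟ⱽ a
     | trans (sym (lookup-map v (λ a′ → does (a′ ≟ⱽ a)) ρ)) ([]=⇒lookup v∈)
... | yes eq | _ = eq
... | no _   | ()

∣level∣≤size : ∀ b (ρ : PartialInput n) → ∣ level (just b) ρ ∣ ≤ size ρ
∣level∣≤size b ρ = p⊆q⇒∣p∣≤∣q∣ {q = Vec.map is-just ρ} λ {v} v∈ →
  lookup⇒[]= v _ (trans (lookup-map v is-just ρ) (cong is-just (∈-level⁻ ρ v∈)))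

fill : Bool → PartialInput n → Input n
fill b = Vec.map (fromMaybe b)

fill-consistent : ∀ b (ρ : PartialInput n) → Consistent ρ (fill b ρ)
fill-consistent b ρ v ≢⋆ rewrite lookup-map v (fromMaybe b) ρ with lookup ρ v
... | just _  = refl
... | nothing = contradiction refl ≢⋆

-- On an edge that the level set misses, every fixed entry of `ρ` is `b`. Filling the free positions
-- with `b` then makes the edge constant and forces the value `b`, which `ρ` excludes.
level-hits : ∀ {G : Hypergraph n} ρ → Intersecting G →
  (∀ x → Consistent ρ x → edgeValue G x ∈ (just (not b) ∷ ⋆ ∷ [])) →
  HittingSet G (level (just (not b)) ρ)
level-hits {b = b} ρ int avoids {e} e∈G =
  decidable-stable (nonempty? _) λ missed →
    excluded (subst (_∈ _) (edgeValue⁺ (fill b ρ) int (lose e∈G (fill-constant missed)))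
                           (avoids (fill b ρ) (fill-consistent b ρ)))
  where
  excluded : ¬ (just b ∈ (just (not b) ∷ ⋆ ∷ []))
  excluded (here eq) = Bool.not-¬ refl (just-injective eq)
  excluded (there (here ()))

  fill-constant : ¬ Nonempty (level (just (not b)) ρ ∩ e) → Constant b (fill b ρ) e
  fill-constant missed v v∈e rewrite lookup-map v (fromMaybe b) ρ
    with lookup ρ v in eq
  ... | nothing = refl
  ... | just a with a Bool.≟ b
  ...   | yes a≡b = a≡b
  ...   | no  a≢b = contradiction
    (v , x∈p∩q⁺ (∈-level⁺ ρ (trans eq (cong just (Bool.¬-not a≢b))) , v∈e)) missed

-- Wherever `ρ` is fixed it agrees with `c`, so the level set lies in a single colour class.
level-monochromatic : ∀ (c : Colouring n) ρ →
  Consistent ρ (tabulate c) → Monochromatic c (level (just b) ρ)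
level-monochromatic {b = b} c ρ con u∈ v∈ = trans (colour u∈) (sym (colour v∈))
  where
  colour : ∀ {u} → u ∈ˢ level (just b) ρ → c u ≡ b
  colour {u} u∈ = trans (sym (lookup∘tabulate c u))
    (just-injective (trans (sym (con u (just⇒≢⋆ ρu))) ρu))
    where
    ρu = ∈-level⁻ ρ u∈

-- The colouring as a hard input.

no-constantEdge : ∀ {G : Hypergraph n} {c : Colouring n} → Intersecting G →
  (∀ U → Monochromatic c U → HittingSet G U → h ≤ ∣ U ∣) → rank G < h →
  ∀ b → ¬ ConstantEdge G b (tabulate c)
no-constantEdge {c = c} int large r<h b p with find p
... | e , e∈G , ce =
  -- Since `G` is intersecting, `e` is itself a hitting set; this is `int e∈G`.
  <⇒≱ r<h (≤-trans (large e (λ u∈ v∈ → trans (colour u∈) (sym (colour v∈))) (int e∈G))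
                   (∣edge∣≤rank e∈G))
  where
  colour : ∀ {u} → u ∈ˢ e → c u ≡ b
  colour {u} u∈ = trans (sym (lookup∘tabulate c u)) (ce u u∈)

theorem2p2 : ∀ (n : ℕ) (G : Hypergraph n) (c : Colouring n) (h : ℕ) →
    Intersecting G →
    (∀ (U : Subset n) → Monochromatic c U → HittingSet G U → h ≤ ∣ U ∣) →
    rank G < h →
    Σ[ f ∈ PartialFunction n ] Σ[ x ∈ Input n ]
    (f x ≡ ⋆ × C f ≤ rank G × h ≤ C-at not-0 f x ⊓ C-at not-1 f x × Monotone f)
theorem2p2 n G c h int large r<h =
  f , x , fx , C-edgeValue≤rank int , ⊓-glb (hard false) (hard true) ,
  edgeValue-monotone int
  where
  f = edgeValue G
  x = tabulate c

  fx : f x ≡ ⋆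
  fx = edgeValue-⋆ (no-constantEdge int large r<h)

  -- The list of values computes to `not-0` for `b = false` and to `not-1` for `b = true`.
  hard : ∀ b → h ≤ C-at (just (not b) ∷ ⋆ ∷ []) f x
  hard b = ≤-C-at f (there (here fx)) λ ρ (con , avoids) →
    ≤-trans (large (level (just (not b)) ρ) (level-monochromatic c ρ con)
                   (level-hits ρ int avoids))
            (∣level∣≤size (not b) ρ)
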